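{- The sufficient condition "$\alpha+4\beta<W$" for the non-existence of an optimal 2WCST rooted at two consecutive equal-to tests (where $\alpha\ge\beta$ are the two heaviest key weights and $W$ is the total weight) is tight for $\alpha\ge\tfrac13$, in the following sense. For all real numbers $\alpha,\beta$ with $0\le\beta\le\alpha$, $\alpha+4\beta=1$ and $\alpha\ge\tfrac13$, there is an instance with total weight $1$, whose heaviest key weight is $\alpha$ and second heaviest key weight is $\beta$, that has an optimal 2WCST rooted at two consecutive equal-to tests.
   Context: An instance is a finite linearly ordered set $\mathcal K$ of $n$ keys, each key $k$ having a weight $w_k\ge 0$. A two-way comparison search tree (2WCST) for $\mathcal K$ is a rooted binary decision tree whose leaves are in bijection with the keys of $\mathcal K$ and in which each internal node is labelled either with an equal-to test $\langle =k\rangle$ ("is $q=k$?") or a less-than test $\langle <k\rangle$ ("is $q<k$?") for a key $k\in\mathcal K$, and has two children, one for the answer "yes" and one for the answer "no". It is required that for each query $q\in\mathcal K$, the search starting at the root ends in the leaf labelled $q$. The cost of $T$ is $\sum_{k}w_k\cdot \mathrm{depth}(k)$, where $\mathrm{depth}(k)$ is the number of comparison nodes on the path from the root to leaf $k$; $T$ is optimal if its cost is minimum among all 2WCSTs for the instance. The first and second heaviest weights are counted with multiplicity. A tree is rooted at two consecutive equal-to tests if its root is an equal-to test and the "no"-child of the root is also an equal-to test. -}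

module Defs where

open import Algebra.Bundles.Raw using (RawMonoid)
import Algebra.Definitions.RawMonoid as RawMonoidDefinitions
open import Data.Bool.Base using (Bool; if_then_else_)
open import Data.Fin.Base as Fin using (Fin)
import Data.Fin.Properties as Fin
open import Data.Nat.Base as ℕ using (ℕ; zero; suc)
import Data.Nat.Properties as ℕ
open import Data.Product.Base using (∃-syntax; _×_; _,_)
open import Data.Rational.Base as ℚ using (ℚ; 0ℚ; 1ℚ; ½)
import Data.Rational.Properties as ℚ
open import Data.Rational.Solver using (module +-*-Solver)
open import Data.Vec.Functional using (Vector)
open import Function.Bundles using (_↔_; module Inverse)
open import Level using (0ℓ)
open import Relation.Binary.PropositionalEquality
  using (_≡_; _≢_; refl; sym; trans; cong; subst)
open import Relation.Nullary.Decidable using (⌊_⌋)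

-- Real numbers: Cauchy sequences of rationals, considered up to _≈_.

IsCauchy : (ℕ → ℚ) → Set
IsCauchy x = ∀ ε → 0ℚ ℚ.< ε → ∃[ N ] (∀ m n → N ℕ.≤ m → N ℕ.≤ n →
  ℚ.∣ x m ℚ.- x n ∣ ℚ.≤ ε)

record ℝ : Set where
  constructor mkℝ
  field
    seq    : ℕ → ℚ
    cauchy : IsCauchy seq

open ℝ public

infix  4 _≈_ _≤_
infixl 6 _+_

_≈_ : ℝ → ℝ → Set
x ≈ y = ∀ ε → 0ℚ ℚ.< ε → ∃[ N ] (∀ n → N ℕ.≤ n →
  ℚ.∣ seq x n ℚ.- seq y n ∣ ℚ.≤ ε)

-- Comparing the sequences termwise would not respect _≈_, hence the ε.
_≤_ : ℝ → ℝ → Set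
x ≤ y = ∀ ε → 0ℚ ℚ.< ε → ∃[ N ] (∀ n → N ℕ.≤ n →
  seq x n ℚ.≤ seq y n ℚ.+ ε)

fromℚ : ℚ → ℝ
fromℚ p = mkℝ (λ _ → p) λ ε 0<ε → 0 , λ _ _ _ _ →
  subst (λ r → ℚ.∣ r ∣ ℚ.≤ ε) (sym (ℚ.+-inverseʳ p)) (ℚ.<⇒≤ 0<ε)

0ℝ 1ℝ : ℝ
0ℝ = fromℚ 0ℚ
1ℝ = fromℚ 1ℚ

private
  halves : ∀ ε → ½ ℚ.* ε ℚ.+ ½ ℚ.* ε ≡ ε
  halves ε = trans (sym (ℚ.*-distribʳ-+ ε ½ ½)) (ℚ.*-identityˡ ε)

  half-pos : ∀ {ε} → 0ℚ ℚ.< ε → 0ℚ ℚ.< ½ ℚ.* ε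
  half-pos 0<ε = ℚ.*-monoʳ-<-pos ½ 0<ε

  regroup : ∀ a b c d → (a ℚ.+ b) ℚ.- (c ℚ.+ d) ≡ (a ℚ.- c) ℚ.+ (b ℚ.- d)
  regroup = solve 4 (λ a b c d → (a :+ b) :- (c :+ d) := (a :- c) :+ (b :- d)) refl
    where open +-*-Solver

  +-cauchy : ∀ x y → IsCauchy x → IsCauchy y → IsCauchy (λ n → x n ℚ.+ y n)
  +-cauchy x y cx cy ε 0<ε =
    let M , p = cx (½ ℚ.* ε) (half-pos 0<ε)
        N , q = cy (½ ℚ.* ε) (half-pos 0<ε)
    in M ℕ.⊔ N , λ m n m≥ n≥ →
      let open ℚ.≤-Reasoning in begin
        ℚ.∣ (x m ℚ.+ y m) ℚ.- (x n ℚ.+ y n) ∣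
          ≡⟨ cong ℚ.∣_∣ (regroup (x m) (y m) (x n) (y n)) ⟩
        ℚ.∣ (x m ℚ.- x n) ℚ.+ (y m ℚ.- y n) ∣
          ≤⟨ ℚ.∣p+q∣≤∣p∣+∣q∣ (x m ℚ.- x n) (y m ℚ.- y n) ⟩
        ℚ.∣ x m ℚ.- x n ∣ ℚ.+ ℚ.∣ y m ℚ.- y n ∣
          ≤⟨ ℚ.+-mono-≤
               (p m n (ℕ.m⊔n≤o⇒m≤o M N m≥) (ℕ.m⊔n≤o⇒m≤o M N n≥))
               (q m n (ℕ.m⊔n≤o⇒n≤o M N m≥) (ℕ.m⊔n≤o⇒n≤o M N n≥)) ⟩
        ½ ℚ.* ε ℚ.+ ½ ℚ.* ε
          ≡⟨ halves ε ⟩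
        ε ∎

_+_ : ℝ → ℝ → ℝ
x + y = mkℝ (λ n → seq x n ℚ.+ seq y n) (+-cauchy (seq x) (seq y) (cauchy x) (cauchy y))

+-0-rawMonoid : RawMonoid 0ℓ 0ℓ
+-0-rawMonoid = record { Carrier = ℝ ; _≈_ = _≈_ ; _∙_ = _+_ ; ε = 0ℝ }

-- m · x is the sum of m copies of x.
open RawMonoidDefinitions +-0-rawMonoid public
  using (sum) renaming (_×_ to infixr 8 _·_)

-- A finite linear order with n elements is represented by Fin n with its
-- standard order.

record Instance (n : ℕ) : Set where
  field
    weight   : Vector ℝ n
    weight≥0 : ∀ k → 0ℝ ≤ weight k

open Instance public

totalWeight : ∀ {n} → Instance n → ℝ
totalWeight I = sum (weight I)

-- The two keys must be distinct, but their weights may coincide: weights are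
-- counted with multiplicity.
TwoHeaviest : ∀ {n} → Instance n → ℝ → ℝ → Set
TwoHeaviest I α β = ∃[ i ] ∃[ j ] i ≢ j
  × weight I i ≈ α × weight I j ≈ β × weight I j ≤ weight I i
  × (∀ k → k ≢ i → k ≢ j → weight I k ≤ weight I j)

data Test (n : ℕ) : Set where
  equalTo lessThan : Fin n → Test n

answer : ∀ {n} → Test n → Fin n → Bool
answer (equalTo k)  q = ⌊ q Fin.≟ k ⌋
answer (lessThan k) q = ⌊ q Fin.<? k ⌋

data Tree (n : ℕ) : Set where
  leaf : Tree n
  node : Test n → (yes no : Tree n) → Tree n

data Leaf {n : ℕ} : Tree n → Set where
  here  : Leaf leaf
  inYes : ∀ {t y z} → Leaf y → Leaf (node t y z)
  inNo  : ∀ {t y z} → Leaf z → Leaf (node t y z)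

leafDepth : ∀ {n} {T : Tree n} → Leaf T → ℕ
leafDepth here      = 0
leafDepth (inYes l) = suc (leafDepth l)
leafDepth (inNo l)  = suc (leafDepth l)

search : ∀ {n} (T : Tree n) → Fin n → Leaf T
search leaf         q = here
search (node t y z) q =
  if answer t q then inYes (search y q) else inNo (search z q)

record 2WCST (n : ℕ) : Set where
  field
    tree     : Tree n
    labels   : Leaf tree ↔ Fin n
    searches : ∀ q → Inverse.to labels (search tree q) ≡ q

  depth : Fin n → ℕ
  depth k = leafDepth (Inverse.from labels k)

open 2WCST public

cost : ∀ {n} → Instance n → 2WCST n → ℝ
cost I T = sum (λ k → depth T k · weight I k)

Optimal : ∀ {n} → Instance n → 2WCST n → Set
Optimal I T = ∀ T′ → cost I T ≤ cost I T′

data RootedAtTwoEqualTo {n : ℕ} : Tree n → Set where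
  twoEqualTo : ∀ {k k′ y y′ z} →
    RootedAtTwoEqualTo (node (equalTo k) y (node (equalTo k′) y′ z))

{-# OPTIONS --safe #-}

-- Take seven keys of weights 0, α, β, β, β, β, 0.  Testing for the five heavy
-- keys one after the other costs α + 14β.  An arbitrary tree costs Aα + Bβ, where
-- A ≥ 1 is the depth of α and B the sum of the depths of the four β's.  Since
-- α ≥ 2β (that is, α ≥ 1/3), it suffices that 2A + B ≥ 16, the claim that the
-- integer weights 0, 2, 1, 1, 1, 1, 0 need cost 16.  This follows by induction on
-- the tree from a potential on the sets of keys that can reach a node.

module Submission where

open import Defs
open import Data.Integer.Base using (+_)
open import Data.Product.Base using (_×_; ∃-syntax; Σ-syntax)
open import Data.Rational.Base using (_/_)

open import Algebra.Bundles using (CommutativeMonoid)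
import Algebra.Properties.CommutativeMonoid.Mult as Mult
import Algebra.Properties.CommutativeMonoid.Sum as Sum
open import Data.Bool.Base using (Bool; true; false; not; _∧_; if_then_else_)
import Data.Bool.Properties as Bool
open import Data.Fin.Base using (Fin)
open import Data.Fin.Patterns using (0F; 1F; 2F; 3F; 4F; 5F; 6F)
import Data.Fin.Properties as Fin
open import Data.Fin.Subset using (Subset; ∣_∣; ⊤)
open import Data.Nat.Base as ℕ using (ℕ; zero; suc; z≤n; s≤s)
import Data.Nat.Properties as ℕ
open import Data.Nat.Tactic.RingSolver using (solve-∀)
open import Data.Product.Base using (_,_)
open import Data.Rational.Base as ℚ using (ℚ; 0ℚ; 1ℚ; ½)
import Data.Rational.Properties as ℚ
open import Data.Rational.Solver using (module +-*-Solver)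
open import Data.Sum.Base using (_⊎_; inj₁; inj₂)
open import Data.Vec.Base using ([]; _∷_; lookup; tabulate)
open import Data.Vec.Properties using (lookup∘tabulate)
open import Function.Base using (_∘_; _$_)
open import Function.Bundles using (module Inverse; mk↔ₛ′)
open import Level using (0ℓ)
open import Relation.Binary.Bundles using (Preorder)
open import Relation.Binary.PropositionalEquality
import Relation.Binary.Reasoning.Preorder as PreorderReasoning
open import Relation.Nullary.Decidable
  using (Dec; map′; from-yes; _×-dec_; _⊎-dec_; ¬?)
open import Relation.Nullary.Negation using (contradiction)
open import Relation.Unary using (Decidable)

-- Order and addition on ℝ

private
  half : ℚ → ℚ
  half ε = ½ ℚ.* ε

  half-pos : ∀ {ε} → 0ℚ ℚ.< ε → 0ℚ ℚ.< half ε
  half-pos = ℚ.*-monoʳ-<-pos ½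

  half+half : ∀ ε → half ε ℚ.+ half ε ≡ ε
  half+half ε = trans (sym (ℚ.*-distribʳ-+ ε ½ ½)) (ℚ.*-identityˡ ε)

Eventually : (ℕ → Set) → Set
Eventually P = ∃[ N ] (∀ n → N ℕ.≤ n → P n)

eventually-map₂ : ∀ {P Q R : ℕ → Set} → (∀ n → P n → Q n → R n) →
  Eventually P → Eventually Q → Eventually R
eventually-map₂ f (M , p) (N , q) = M ℕ.⊔ N , λ n n≥ →
  f n (p n (ℕ.m⊔n≤o⇒m≤o M N n≥)) (q n (ℕ.m⊔n≤o⇒n≤o M N n≥))

p≤∣p∣ : ∀ p → p ℚ.≤ ℚ.∣ p ∣
p≤∣p∣ p with ℚ.≤-total 0ℚ p
... | inj₁ 0≤p = ℚ.≤-reflexive (sym (ℚ.0≤p⇒∣p∣≡p 0≤p))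
... | inj₂ p≤0 = ℚ.≤-trans p≤0 (ℚ.0≤∣p∣ p)

∣p-q∣≤r⇒p≤q+r : ∀ p q {r} → ℚ.∣ p ℚ.- q ∣ ℚ.≤ r → p ℚ.≤ q ℚ.+ r
∣p-q∣≤r⇒p≤q+r p q {r} h = begin
  p                      ≡⟨ solve 2 (λ p q → p := q :+ (p :- q)) refl p q ⟩
  q ℚ.+ (p ℚ.- q)        ≤⟨ ℚ.+-monoʳ-≤ q (p≤∣p∣ (p ℚ.- q)) ⟩
  q ℚ.+ ℚ.∣ p ℚ.- q ∣    ≤⟨ ℚ.+-monoʳ-≤ q h ⟩
  q ℚ.+ r                ∎
  where open ℚ.≤-Reasoning
        open +-*-Solver

p≤q+r⇒p-q≤r : ∀ p q {r} → p ℚ.≤ q ℚ.+ r → p ℚ.- q ℚ.≤ r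
p≤q+r⇒p-q≤r p q {r} h = begin
  p ℚ.- q            ≤⟨ ℚ.+-monoˡ-≤ (ℚ.- q) h ⟩
  (q ℚ.+ r) ℚ.- q    ≡⟨ solve 2 (λ q r → (q :+ r) :- q := r) refl q r ⟩
  r                  ∎
  where open ℚ.≤-Reasoning
        open +-*-Solver

∣p-q∣≤r : ∀ p q {r} → p ℚ.≤ q ℚ.+ r → q ℚ.≤ p ℚ.+ r → ℚ.∣ p ℚ.- q ∣ ℚ.≤ r
∣p-q∣≤r p q h h′ with ℚ.∣p∣≡p∨∣p∣≡-p (p ℚ.- q)
... | inj₁ eq = subst (ℚ._≤ _) (sym eq) (p≤q+r⇒p-q≤r p q h)
... | inj₂ eq = subst (ℚ._≤ _) (sym (trans eq (swap p q))) (p≤q+r⇒p-q≤r q p h′)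
  where
  open +-*-Solver
  swap : ∀ p q → ℚ.- (p ℚ.- q) ≡ q ℚ.- p
  swap = solve 2 (λ p q → :- (p :- q) := q :- p) refl

≈⇒≤ : ∀ {x y} → x ≈ y → x ≤ y
≈⇒≤ {x} {y} x≈y ε 0<ε with N , p ← x≈y ε 0<ε =
  N , λ n n≥ → ∣p-q∣≤r⇒p≤q+r (seq x n) (seq y n) (p n n≥)

-- With this, transitivity and congruence of `_≈_` reduce to the order laws, so that ε is split into
-- halves only in proofs about `_≤_`.
≤-antisym : ∀ {x y} → x ≤ y → y ≤ x → x ≈ y
≤-antisym {x} {y} x≤y y≤x ε 0<ε =
  eventually-map₂ (λ n → ∣p-q∣≤r (seq x n) (seq y n)) (x≤y ε 0<ε) (y≤x ε 0<ε)

≗⇒≤ : ∀ {x y} → seq x ≗ seq y → x ≤ y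
≗⇒≤ {x} {y} x≗y ε 0<ε = 0 , λ n _ → begin
  seq x n            ≡⟨ x≗y n ⟩
  seq y n            ≡⟨ ℚ.+-identityʳ (seq y n) ⟨
  seq y n ℚ.+ 0ℚ     ≤⟨ ℚ.+-monoʳ-≤ (seq y n) (ℚ.<⇒≤ 0<ε) ⟩
  seq y n ℚ.+ ε      ∎
  where open ℚ.≤-Reasoning

-- Addition acts termwise, so identities of ℚ carry over to ℝ; the associativity, unit and
-- commutativity laws and the cost formula are obtained in this way.
≗⇒≈ : ∀ {x y} → seq x ≗ seq y → x ≈ y
≗⇒≈ {x} {y} x≗y = ≤-antisym {x} {y} (≗⇒≤ {x} {y} x≗y) (≗⇒≤ {y} {x} (sym ∘ x≗y))

≤-refl : ∀ {x} → x ≤ x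
≤-refl {x} = ≗⇒≤ {x} {x} (λ _ → refl)

≤-trans : ∀ {x y z} → x ≤ y → y ≤ z → x ≤ z
≤-trans {x} {y} {z} x≤y y≤z ε 0<ε =
  eventually-map₂ step (x≤y h (half-pos 0<ε)) (y≤z h (half-pos 0<ε))
  where
  h = half ε
  open ℚ.≤-Reasoning
  step : ∀ n → seq x n ℚ.≤ seq y n ℚ.+ h → seq y n ℚ.≤ seq z n ℚ.+ h →
         seq x n ℚ.≤ seq z n ℚ.+ ε
  step n p q = begin
    seq x n                    ≤⟨ p ⟩
    seq y n ℚ.+ h              ≤⟨ ℚ.+-monoˡ-≤ h q ⟩
    (seq z n ℚ.+ h) ℚ.+ h      ≡⟨ ℚ.+-assoc (seq z n) h h ⟩
    seq z n ℚ.+ (h ℚ.+ h)      ≡⟨ cong (seq z n ℚ.+_) (half+half ε) ⟩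
    seq z n ℚ.+ ε              ∎

+-mono-≤ : ∀ {x y u v} → x ≤ y → u ≤ v → x + u ≤ y + v
+-mono-≤ {x} {y} {u} {v} x≤y u≤v ε 0<ε =
  eventually-map₂ step (x≤y h (half-pos 0<ε)) (u≤v h (half-pos 0<ε))
  where
  h = half ε
  open ℚ.≤-Reasoning
  open +-*-Solver
  step : ∀ n → seq x n ℚ.≤ seq y n ℚ.+ h → seq u n ℚ.≤ seq v n ℚ.+ h →
         seq x n ℚ.+ seq u n ℚ.≤ (seq y n ℚ.+ seq v n) ℚ.+ ε
  step n p q = begin
    seq x n ℚ.+ seq u n
      ≤⟨ ℚ.+-mono-≤ p q ⟩
    (seq y n ℚ.+ h) ℚ.+ (seq v n ℚ.+ h)
      ≡⟨ solve 3 (λ a b h → (a :+ h) :+ (b :+ h) := (a :+ b) :+ (h :+ h)) refl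
           (seq y n) (seq v n) h ⟩
    (seq y n ℚ.+ seq v n) ℚ.+ (h ℚ.+ h)
      ≡⟨ cong ((seq y n ℚ.+ seq v n) ℚ.+_) (half+half ε) ⟩
    (seq y n ℚ.+ seq v n) ℚ.+ ε ∎

≈-sym : ∀ {x y} → x ≈ y → y ≈ x
≈-sym {x} {y} x≈y ε 0<ε with N , p ← x≈y ε 0<ε = N , λ n n≥ →
  subst (ℚ._≤ ε) (∣-∣-comm (seq x n) (seq y n)) (p n n≥)
  where
  open +-*-Solver
  ∣-∣-comm : ∀ p q → ℚ.∣ p ℚ.- q ∣ ≡ ℚ.∣ q ℚ.- p ∣
  ∣-∣-comm p q = trans (sym (ℚ.∣-p∣≡∣p∣ (p ℚ.- q)))
    (cong ℚ.∣_∣ (solve 2 (λ p q → :- (p :- q) := q :- p) refl p q))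

≈⇒≥ : ∀ {x y} → x ≈ y → y ≤ x
≈⇒≥ {x} {y} = ≈⇒≤ {y} {x} ∘ ≈-sym {x} {y}

-- The additive monoid of ℝ and its multiples

+-0-commutativeMonoid : CommutativeMonoid 0ℓ 0ℓ
+-0-commutativeMonoid = record
  { Carrier = ℝ
  ; _≈_ = _≈_
  ; _∙_ = _+_
  ; ε = 0ℝ
  ; isCommutativeMonoid = record
    { isMonoid = record
      { isSemigroup = record
        { isMagma = record
          { isEquivalence = record
            { refl = λ {x} → ≗⇒≈ {x} {x} (λ _ → refl)
            ; sym = λ {x} {y} → ≈-sym {x} {y}
            ; trans = λ {x} {y} {z} x≈y y≈z → ≤-antisym {x} {z}
                (≤-trans {x} {y} {z} (≈⇒≤ {x} {y} x≈y) (≈⇒≤ {y} {z} y≈z))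
                (≤-trans {z} {y} {x} (≈⇒≥ {y} {z} y≈z) (≈⇒≥ {x} {y} x≈y))
            }
          ; ∙-cong = λ {x} {y} {u} {v} x≈y u≈v → ≤-antisym {x + u} {y + v}
              (+-mono-≤ {x} {y} {u} {v} (≈⇒≤ {x} {y} x≈y) (≈⇒≤ {u} {v} u≈v))
              (+-mono-≤ {y} {x} {v} {u} (≈⇒≥ {x} {y} x≈y) (≈⇒≥ {u} {v} u≈v))
          }
        ; assoc = λ x y z → ≗⇒≈ {(x + y) + z} {x + (y + z)}
            (λ n → ℚ.+-assoc (seq x n) (seq y n) (seq z n))
        }
      ; identity =
          (λ x → ≗⇒≈ {0ℝ + x} {x} (λ n → ℚ.+-identityˡ (seq x n))) ,
          (λ x → ≗⇒≈ {x + 0ℝ} {x} (λ n → ℚ.+-identityʳ (seq x n)))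
      }
    ; comm = λ x y → ≗⇒≈ {x + y} {y + x} (λ n → ℚ.+-comm (seq x n) (seq y n))
    }
  }

open CommutativeMonoid +-0-commutativeMonoid using ()
  renaming (refl to ≈-refl; trans to ≈-trans; ∙-congˡ to +-congˡ; assoc to +-assoc;
            identityˡ to +-identityˡ; identityʳ to +-identityʳ;
            isEquivalence to ≈-isEquivalence)

-- Kept as an equality of terms in ℚ so that `linear-cost` can rewrite with it.
seq-·-homo-+ : ∀ x m k n → seq ((m ℕ.+ k) · x) n ≡ seq (m · x) n ℚ.+ seq (k · x) n
seq-·-homo-+ x zero    k n = sym (ℚ.+-identityˡ (seq (k · x) n))
seq-·-homo-+ x (suc m) k n = trans
  (cong (seq x n ℚ.+_) (seq-·-homo-+ x m k n))
  (sym (ℚ.+-assoc (seq x n) (seq (m · x) n) (seq (k · x) n)))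

·-homo-+ : ∀ x m k → (m ℕ.+ k) · x ≈ m · x + k · x
·-homo-+ x m k = ≗⇒≈ {(m ℕ.+ k) · x} {m · x + k · x} (seq-·-homo-+ x m k)

·-assocˡ : ∀ x m n → m · n · x ≈ (m ℕ.* n) · x
·-assocˡ = Mult.×-assocˡ +-0-commutativeMonoid

seq-·-zero : ∀ m n → seq (m · 0ℝ) n ≡ 0ℚ
seq-·-zero zero    n = refl
seq-·-zero (suc m) n = trans (ℚ.+-identityˡ (seq (m · 0ℝ) n)) (seq-·-zero m n)

≤-preorder : Preorder 0ℓ 0ℓ 0ℓ
≤-preorder = record
  { Carrier = ℝ
  ; _≈_ = _≈_
  ; _≲_ = _≤_
  ; isPreorder = record
    { isEquivalence = ≈-isEquivalence
    ; reflexive = λ {x} {y} → ≈⇒≤ {x} {y}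
    ; trans = λ {x} {y} {z} → ≤-trans {x} {y} {z}
    }
  }

module ≤-Reasoning = PreorderReasoning ≤-preorder

·-monoʳ-≤ : ∀ m {x y} → x ≤ y → m · x ≤ m · y
·-monoʳ-≤ zero    {x} {y} x≤y = ≤-refl {0ℝ}
·-monoʳ-≤ (suc m) {x} {y} x≤y =
  +-mono-≤ {x} {y} {m · x} {m · y} x≤y (·-monoʳ-≤ m {x} {y} x≤y)

·-monoˡ-≤ : ∀ x {m n} → 0ℝ ≤ x → m ℕ.≤ n → m · x ≤ n · x
·-monoˡ-≤ x {n = zero}  0≤x z≤n = ≤-refl {0ℝ}
·-monoˡ-≤ x {n = suc n} 0≤x z≤n = begin
  0ℝ           ≈⟨ +-identityˡ 0ℝ ⟨
  0ℝ + 0ℝ      ≲⟨ +-mono-≤ {0ℝ} {x} {0ℝ} {n · x} 0≤x (·-monoˡ-≤ x {0} {n} 0≤x z≤n) ⟩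
  x + n · x    ∎
  where open ≤-Reasoning
·-monoˡ-≤ x {suc m} {suc n} 0≤x (s≤s m≤n) =
  +-mono-≤ {x} {x} {m · x} {n · x} (≤-refl {x}) (·-monoˡ-≤ x {m} {n} 0≤x m≤n)

-- Lower bounds on path lengths

private
  module Σℕ = Sum ℕ.+-0-commutativeMonoid

-- `S` is to be read as the set of keys that can reach a node, and `part a S` as those handed on to
-- one child.
part : ∀ {n} → (Fin n → Bool) → Subset n → Subset n
part a S = tabulate (λ k → a k ∧ lookup S k)

yesPart noPart : ∀ {n} → Test n → Subset n → Subset n
yesPart t = part (answer t)
noPart  t = part (not ∘ answer t)

restrict : ∀ {n} → Subset n → (Fin n → ℕ) → Fin n → ℕ
restrict S v k = if lookup S k then v k else 0

subsetWeight : ∀ {n} → (Fin n → ℕ) → Subset n → ℕ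
subsetWeight w S = Σℕ.sum (restrict S w)

-- Depths are read off from `search` rather than from leaf labels, because the induction passes to
-- subtrees, whose leaves carry only some of the keys.
pathLength : ∀ {n} → (Fin n → ℕ) → Tree n → Subset n → ℕ
pathLength w T S = Σℕ.sum (restrict S (λ k → w k ℕ.* leafDepth (search T k)))

-- The root charges each key of `S` its weight once; every further comparison for that key happens
-- in exactly one of the two subtrees.
pathLength-node : ∀ {n} (w : Fin n → ℕ) t y z S →
  pathLength w (node t y z) S ≡
  subsetWeight w S ℕ.+ (pathLength w y (yesPart t S) ℕ.+ pathLength w z (noPart t S))
pathLength-node w t y z S = begin
  Σℕ.sum (restrict S (λ k → w k ℕ.* leafDepth (search (node t y z) k)))
    ≡⟨ Σℕ.sum-cong-≗ split ⟩
  Σℕ.sum (λ k → restrict S w k ℕ.+ (inY k ℕ.+ inN k))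
    ≡⟨ Σℕ.∑-distrib-+ (restrict S w) (λ k → inY k ℕ.+ inN k) ⟩
  subsetWeight w S ℕ.+ Σℕ.sum (λ k → inY k ℕ.+ inN k)
    ≡⟨ cong (subsetWeight w S ℕ.+_) (Σℕ.∑-distrib-+ inY inN) ⟩
  subsetWeight w S ℕ.+ (Σℕ.sum inY ℕ.+ Σℕ.sum inN) ∎
  where
  open ≡-Reasoning
  inY inN : Fin _ → ℕ
  inY = restrict (yesPart t S) (λ k → w k ℕ.* leafDepth (search y k))
  inN = restrict (noPart t S) (λ k → w k ℕ.* leafDepth (search z k))
  split : ∀ k → restrict S (λ k → w k ℕ.* leafDepth (search (node t y z) k)) k ≡
                restrict S w k ℕ.+ (inY k ℕ.+ inN k)
  split k
    rewrite lookup∘tabulate (λ k → answer t k ∧ lookup S k) k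
          | lookup∘tabulate (λ k → not (answer t k) ∧ lookup S k) k
    with answer t k | lookup S k
  ... | true  | true  = trans (ℕ.*-suc (w k) _) (cong (w k ℕ.+_) (sym (ℕ.+-identityʳ _)))
  ... | false | true  = ℕ.*-suc (w k) _
  ... | true  | false = refl
  ... | false | false = refl

-- The consequence of the bijection between leaves and keys that survives in subtrees, once `S` is
-- cut down accordingly.
SeparatesOn : ∀ {n} → Subset n → Tree n → Set
SeparatesOn S T = ∀ p q → lookup S p ≡ true → lookup S q ≡ true →
  search T p ≡ search T q → p ≡ q

∧-true : ∀ a b → a ∧ b ≡ true → a ≡ true × b ≡ true
∧-true true true _ = refl , refl

∈-part : ∀ {n} a (S : Subset n) k → lookup (part a S) k ≡ true →
  a k ≡ true × lookup S k ≡ true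
∈-part a S k k∈ = ∧-true (a k) (lookup S k)
  (trans (sym (lookup∘tabulate (λ k → a k ∧ lookup S k) k)) k∈)

module _ {n} {t : Test n} {y z : Tree n} where

  search-yes : ∀ q → answer t q ≡ true → search (node t y z) q ≡ inYes (search y q)
  search-yes q eq rewrite eq = refl

  search-no : ∀ q → not (answer t q) ≡ true → search (node t y z) q ≡ inNo (search z q)
  search-no q eq with answer t q
  ... | false = refl

  -- All keys of the yes-part descend into `y`, so a collision there is already one in the whole
  -- tree.
  separatesOn-yes : ∀ S → SeparatesOn S (node t y z) → SeparatesOn (yesPart t S) y
  separatesOn-yes S sep p q p∈ q∈ eq
    with tp , p∈S ← ∈-part (answer t) S p p∈ | tq , q∈S ← ∈-part (answer t) S q q∈
    = sep p q p∈S q∈S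
        (trans (search-yes p tp) (trans (cong inYes eq) (sym (search-yes q tq))))

  separatesOn-no : ∀ S → SeparatesOn S (node t y z) → SeparatesOn (noPart t S) z
  separatesOn-no S sep p q p∈ q∈ eq
    with tp , p∈S ← ∈-part (not ∘ answer t) S p p∈
       | tq , q∈S ← ∈-part (not ∘ answer t) S q q∈
    = sep p q p∈S q∈S
        (trans (search-no p tp) (trans (cong inNo eq) (sym (search-no q tq))))

Nontrivial : ∀ {n} → Subset n → Set
Nontrivial S = ∃[ p ] ∃[ q ] lookup S p ≡ true × lookup S q ≡ true × p ≢ q

-- A subsolution of the dynamic programming recursion for the optimal cost, with `vanishes` as the
-- condition at leaves. The two kinds of test get separate fields so that each ranges over `Fin n`
-- and can be decided exhaustively.
record IsPotential {n} (w : Fin n → ℕ) (f : Subset n → ℕ) : Set where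
  field
    vanishes : ∀ S → f S ≡ 0 ⊎ Nontrivial S
    equal-step : ∀ S k → let t = equalTo k in
      f S ℕ.≤ subsetWeight w S ℕ.+ (f (yesPart t S) ℕ.+ f (noPart t S))
    less-step : ∀ S k → let t = lessThan k in
      f S ℕ.≤ subsetWeight w S ℕ.+ (f (yesPart t S) ℕ.+ f (noPart t S))

  step : ∀ S t → f S ℕ.≤ subsetWeight w S ℕ.+ (f (yesPart t S) ℕ.+ f (noPart t S))
  step S (equalTo k)  = equal-step S k
  step S (lessThan k) = less-step S k

  potential≤pathLength : ∀ T S → SeparatesOn S T → f S ℕ.≤ pathLength w T S
  potential≤pathLength leaf S sep with vanishes S
  ... | inj₁ fS≡0 = ℕ.≤-trans (ℕ.≤-reflexive fS≡0) z≤n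
  -- All searches end in the same leaf here, so two distinct keys of `S` contradict separation.
  ... | inj₂ (p , q , p∈ , q∈ , p≢q) = contradiction (sep p q p∈ q∈ refl) p≢q
  potential≤pathLength (node t y z) S sep = begin
    f S
      ≤⟨ step S t ⟩
    subsetWeight w S ℕ.+ (f (yesPart t S) ℕ.+ f (noPart t S))
      ≤⟨ ℕ.+-monoʳ-≤ (subsetWeight w S) (ℕ.+-mono-≤
           (potential≤pathLength y (yesPart t S) (separatesOn-yes S sep))
           (potential≤pathLength z (noPart t S) (separatesOn-no S sep))) ⟩
    subsetWeight w S ℕ.+ (pathLength w y (yesPart t S) ℕ.+ pathLength w z (noPart t S))
      ≡⟨ pathLength-node w t y z S ⟨
    pathLength w (node t y z) S ∎
    where open ℕ.≤-Reasoning

-- Deciding the potential conditions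

allSubset? : ∀ {n} {P : Subset n → Set} → Decidable P → Dec (∀ S → P S)
allSubset? {zero}  P? = map′ (λ { p [] → p }) (_$ []) (P? [])
allSubset? {suc n} P? = map′
  (λ { (p , q) (true ∷ S) → p S ; (p , q) (false ∷ S) → q S })
  (λ p → p ∘ (true ∷_) , p ∘ (false ∷_))
  (allSubset? (P? ∘ (true ∷_)) ×-dec allSubset? (P? ∘ (false ∷_)))

isPotential? : ∀ {n} w (f : Subset n → ℕ) → Dec (IsPotential w f)
isPotential? w f = map′
  (λ { (v , e , l) → record { vanishes = v ; equal-step = e ; less-step = l } })
  (λ p → IsPotential.vanishes p , IsPotential.equal-step p , IsPotential.less-step p)
  (allSubset? (λ S → (f S ℕ.≟ 0) ⊎-dec Fin.any? λ p → Fin.any? λ q →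
      (lookup S p Bool.≟ true) ×-dec (lookup S q Bool.≟ true) ×-dec ¬? (p Fin.≟ q))
   ×-dec allSubset? (λ S → Fin.all? λ k → _ ℕ.≤? _)
   ×-dec allSubset? (λ S → Fin.all? λ k → _ ℕ.≤? _))

-- Depths in search trees

module _ {n} (T : 2WCST n) where

  open Inverse (labels T) using (to; from; strictlyInverseˡ; strictlyInverseʳ)

  from≡search : ∀ q → from q ≡ search (tree T) q
  from≡search q = trans (cong from (sym (searches T q))) (strictlyInverseʳ (search (tree T) q))

  from-injective : ∀ {p q} → from p ≡ from q → p ≡ q
  from-injective {p} {q} eq =
    trans (sym (strictlyInverseˡ p)) (trans (cong to eq) (strictlyInverseˡ q))

  tree-separates : ∀ S → SeparatesOn S (tree T)
  tree-separates S p q _ _ eq =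
    from-injective (trans (from≡search p) (trans eq (sym (from≡search q))))

  depth≡leafDepth-search : ∀ q → depth T q ≡ leafDepth (search (tree T) q)
  depth≡leafDepth-search q = cong leafDepth (from≡search q)

  -- A leaf at depth 0 is the whole tree, which leaves no leaf for a second key.
  depth-positive : ∀ {p q} → p ≢ q → 0 ℕ.< depth T p
  depth-positive {p} {q} p≢q = positive (from p) (from q) (p≢q ∘ from-injective)
    where
    positive : ∀ {T : Tree n} (l l′ : Leaf T) → l ≢ l′ → 0 ℕ.< leafDepth l
    positive here      here l≢l′ = contradiction refl l≢l′
    positive (inYes l) _    _    = ℕ.z<s
    positive (inNo l)  _    _    = ℕ.z<s

-- The extremal instance

-- The weights (0, α, β, β, β, β, 0) in the extreme case α = 2β, in units of β.
intWeight : Fin 7 → ℕ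
intWeight = lookup (0 ∷ 2 ∷ 1 ∷ 1 ∷ 1 ∷ 1 ∷ 0 ∷ [])

-- The optimal cost of a search tree for the keys in S.  If both weightless end
-- keys are present, equal-to tests in order of decreasing weight are optimal; a
-- missing one makes some less-than tests cheaper, which accounts for the correction.
potential : Subset 7 → ℕ
potential S@(l ∷ a ∷ b₁ ∷ b₂ ∷ b₃ ∷ b₄ ∷ r ∷ []) =
  if ∣ S ∣ ℕ.≤ᵇ 1 then 0
  -- The β's tested in turn cost 1 + ... + m. Testing α before them costs 2 and delays each of the m
  -- β's by one comparison.
  else (m ℕ.* (m ℕ.+ 1) ℕ./ 2 ℕ.+ (if a then 2 ℕ.+ m else 0)) ℕ.∸ correction l r
  where
  m : ℕ
  m = ∣ b₁ ∷ b₂ ∷ b₃ ∷ b₄ ∷ [] ∣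
  correction : Bool → Bool → ℕ
  correction true  true  = 0
  -- Without end keys the last heavy key needs no test of its own, which saves 1. The quotient is 1
  -- only when all four β's are present: then splitting them evenly by less-than tests saves 1 more.
  correction false false = suc (m ℕ./ 4)
  correction _     _     = m ℕ./ 4

-- A finite check by evaluation, over 128 subsets with 14 tests each.
potential-isPotential : IsPotential intWeight potential
potential-isPotential = from-yes (isPotential? intWeight potential)

βDepth : 2WCST 7 → ℕ
βDepth T = depth T 2F ℕ.+ (depth T 3F ℕ.+ (depth T 4F ℕ.+ depth T 5F))

16≤2αDepth+βDepth : ∀ T → 16 ℕ.≤ 2 ℕ.* depth T 1F ℕ.+ βDepth T
16≤2αDepth+βDepth T = begin
  16
    -- On the full key set the potential evaluates to 4 · 5 / 2 + (2 + 4) = 16, with correction 0.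
    ≤⟨ IsPotential.potential≤pathLength potential-isPotential (tree T) ⊤
         (tree-separates T ⊤) ⟩
  pathLength intWeight (tree T) ⊤
    ≡⟨ Σℕ.sum-cong-≗ (λ k → cong (intWeight k ℕ.*_) (depth≡leafDepth-search T k)) ⟨
  Σℕ.sum (λ k → intWeight k ℕ.* depth T k)
    ≡⟨ regroup (depth T 1F) (depth T 2F) (depth T 3F) (depth T 4F) (depth T 5F) ⟩
  2 ℕ.* depth T 1F ℕ.+ βDepth T ∎
  where
  open ℕ.≤-Reasoning
  regroup : ∀ a b c d e →
    2 ℕ.* a ℕ.+ (1 ℕ.* b ℕ.+ (1 ℕ.* c ℕ.+ (1 ℕ.* d ℕ.+ (1 ℕ.* e ℕ.+ 0)))) ≡
    2 ℕ.* a ℕ.+ (b ℕ.+ (c ℕ.+ (d ℕ.+ e)))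
  regroup = solve-∀

chain : 2WCST 7
chain = record
  { tree     = T
  -- The inverse of `label` is `search` itself, so `label-search` is at once an inverse law and the
  -- correctness of the searches.
  ; labels   = mk↔ₛ′ label (search T) label-search search-label
  ; searches = label-search
  }
  where
  T : Tree 7
  T = node (equalTo 1F) leaf (node (equalTo 2F) leaf (node (equalTo 3F) leaf
     -- After the five equal-to tests only the weightless keys `0F` and `6F` remain, and one
     -- less-than test tells them apart.
     (node (equalTo 4F) leaf (node (equalTo 5F) leaf (node (lessThan 6F) leaf leaf)))))

  label : Leaf T → Fin 7
  label (inYes here)                                    = 1F
  label (inNo (inYes here))                             = 2F
  label (inNo (inNo (inYes here)))                      = 3F
  label (inNo (inNo (inNo (inYes here))))               = 4F
  label (inNo (inNo (inNo (inNo (inYes here)))))        = 5F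
  label (inNo (inNo (inNo (inNo (inNo (inYes here)))))) = 0F
  label (inNo (inNo (inNo (inNo (inNo (inNo here))))))  = 6F

  label-search : ∀ q → label (search T q) ≡ q
  label-search = from-yes (Fin.all? λ q → label (search T q) Fin.≟ q)

  search-label : ∀ l → search T (label l) ≡ l
  search-label (inYes here)                                    = refl
  search-label (inNo (inYes here))                             = refl
  search-label (inNo (inNo (inYes here)))                      = refl
  search-label (inNo (inNo (inNo (inYes here))))               = refl
  search-label (inNo (inNo (inNo (inNo (inYes here)))))        = refl
  search-label (inNo (inNo (inNo (inNo (inNo (inYes here)))))) = refl
  search-label (inNo (inNo (inNo (inNo (inNo (inNo here))))))  = refl

-- The total gives 2β = (1 - α)/2, and 1 ≤ 3α turns this into at most α.
2β≤α : ∀ α β → α + 4 · β ≈ 1ℝ → fromℚ (+ 1 / 3) ≤ α → 2 · β ≤ α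
2β≤α α β total ⅓≤α ε 0<ε =
  eventually-map₂ step (≈⇒≤ {α + 4 · β} {1ℝ} total h (half-pos 0<ε)) (⅓≤α h (half-pos 0<ε))
  where
  h = half ε
  open ℚ.≤-Reasoning
  open +-*-Solver
  step : ∀ n → seq (α + 4 · β) n ℚ.≤ 1ℚ ℚ.+ h → (+ 1 / 3) ℚ.≤ seq α n ℚ.+ h →
         seq (2 · β) n ℚ.≤ seq α n ℚ.+ ε
  step n p q = begin
    b ℚ.+ (b ℚ.+ 0ℚ)
      ≡⟨ solve 2 (λ a b → b :+ (b :+ con 0ℚ) :=
           con ½ :* ((a :+ (b :+ (b :+ (b :+ (b :+ con 0ℚ))))) :- a)) refl a b ⟩
    ½ ℚ.* (seq (α + 4 · β) n ℚ.- a)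
      ≤⟨ ℚ.*-monoˡ-≤-nonNeg ½ (ℚ.+-monoˡ-≤ (ℚ.- a) bound) ⟩
    ½ ℚ.* ((((a ℚ.+ h) ℚ.+ ((a ℚ.+ h) ℚ.+ (a ℚ.+ h))) ℚ.+ h) ℚ.- a)
      ≡⟨ solve 2 (λ a h → con ½ :*
           ((((a :+ h) :+ ((a :+ h) :+ (a :+ h))) :+ h) :- a) := a :+ (h :+ h)) refl a h ⟩
    a ℚ.+ (h ℚ.+ h)
      ≡⟨ cong (a ℚ.+_) (half+half ε) ⟩
    a ℚ.+ ε ∎
    where
    a = seq α n
    b = seq β n
    bound : seq (α + 4 · β) n ℚ.≤ ((a ℚ.+ h) ℚ.+ ((a ℚ.+ h) ℚ.+ (a ℚ.+ h))) ℚ.+ h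
    -- The 1 is taken as three thirds, each at most a + h. With the error h of the total this makes
    -- four errors, and the factor ½ leaves 2h = ε.
    bound = ℚ.≤-trans p (ℚ.+-monoˡ-≤ h (ℚ.+-mono-≤ q (ℚ.+-mono-≤ q q)))

-- Since A ≥ 1, exchanging α for 2β in the A − 1 surplus copies of α gives the bound.
α+kβ≤Aα+Bβ : ∀ {α β} k A B → 0ℝ ≤ β → 2 · β ≤ α → 0 ℕ.< A →
  2 ℕ.+ k ℕ.≤ 2 ℕ.* A ℕ.+ B → 1 · α + k · β ≤ A · α + B · β
α+kβ≤Aα+Bβ {α} {β} k (suc a) B 0≤β 2β≤α _ 2+k≤ = begin
  1 · α + k · β
    ≲⟨ +-mono-≤ {1 · α} {α} {k · β} {(a ℕ.* 2 ℕ.+ B) · β}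
         (≈⇒≤ {1 · α} {α} (+-identityʳ α)) (·-monoˡ-≤ β {k} {a ℕ.* 2 ℕ.+ B} 0≤β k≤) ⟩
  α + (a ℕ.* 2 ℕ.+ B) · β
    ≈⟨ +-congˡ {α} {(a ℕ.* 2 ℕ.+ B) · β} {(a ℕ.* 2) · β + B · β} (·-homo-+ β (a ℕ.* 2) B) ⟩
  α + ((a ℕ.* 2) · β + B · β)
    ≲⟨ +-mono-≤ {α} {α} {(a ℕ.* 2) · β + B · β} {a · α + B · β} (≤-refl {α})
         (+-mono-≤ {(a ℕ.* 2) · β} {a · α} {B · β} {B · β} exchange (≤-refl {B · β})) ⟩
  α + (a · α + B · β)
    ≈⟨ +-assoc α (a · α) (B · β) ⟨
  suc a · α + B · β ∎
  where
  open ≤-Reasoning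
  -- With A = 1 + a the hypothesis reads 2 + k ≤ 2 + (2a + B).
  k≤ : k ℕ.≤ a ℕ.* 2 ℕ.+ B
  k≤ = ℕ.+-cancelˡ-≤ 2 k (a ℕ.* 2 ℕ.+ B) (subst (2 ℕ.+ k ℕ.≤_) (double a B) 2+k≤)
    where
    double : ∀ a B → 2 ℕ.* suc a ℕ.+ B ≡ 2 ℕ.+ (a ℕ.* 2 ℕ.+ B)
    double = solve-∀
  exchange : (a ℕ.* 2) · β ≤ a · α
  exchange = ≤-trans {(a ℕ.* 2) · β} {a · 2 · β} {a · α}
    (≈⇒≥ {a · 2 · β} {(a ℕ.* 2) · β} (·-assocˡ β a 2)) (·-monoʳ-≤ a {2 · β} {α} 2β≤α)

-- The left side is what `cost extremal T` unfolds to, with the depths generalised to variables;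
-- both sides agree termwise.
linear-cost : ∀ α β d₀ d₁ d₂ d₃ d₄ d₅ d₆ →
  d₀ · 0ℝ + (d₁ · α + (d₂ · β + (d₃ · β + (d₄ · β + (d₅ · β + (d₆ · 0ℝ + 0ℝ)))))) ≈
  d₁ · α + (d₂ ℕ.+ (d₃ ℕ.+ (d₄ ℕ.+ d₅))) · β
linear-cost α β d₀ d₁ d₂ d₃ d₄ d₅ d₆ = ≗⇒≈ {lhs} {rhs} pointwise
  where
  open +-*-Solver
  lhs rhs : ℝ
  lhs = d₀ · 0ℝ + (d₁ · α + (d₂ · β + (d₃ · β + (d₄ · β + (d₅ · β + (d₆ · 0ℝ + 0ℝ))))))
  rhs = d₁ · α + (d₂ ℕ.+ (d₃ ℕ.+ (d₄ ℕ.+ d₅))) · β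
  pointwise : seq lhs ≗ seq rhs
  pointwise n
    rewrite seq-·-zero d₀ n | seq-·-zero d₆ n
          | seq-·-homo-+ β d₂ (d₃ ℕ.+ (d₄ ℕ.+ d₅)) n
          | seq-·-homo-+ β d₃ (d₄ ℕ.+ d₅) n
          | seq-·-homo-+ β d₄ d₅ n
    = solve 5 (λ a b c d e →
        con 0ℚ :+ (a :+ (b :+ (c :+ (d :+ (e :+ (con 0ℚ :+ con 0ℚ)))))) :=
        a :+ (b :+ (c :+ (d :+ e)))) refl
        (seq (d₁ · α) n) (seq (d₂ · β) n) (seq (d₃ · β) n) (seq (d₄ · β) n) (seq (d₅ · β) n)

module _ (α β : ℝ) (0≤β : 0ℝ ≤ β) (β≤α : β ≤ α) where

  extremal : Instance 7
  extremal = record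
    -- The weightless end keys make less-than tests unprofitable. Without them, testing for α and
    -- then halving the β's twice would cost only α + 12β.
    { weight   = lookup (0ℝ ∷ α ∷ β ∷ β ∷ β ∷ β ∷ 0ℝ ∷ [])
    ; weight≥0 = λ where
        0F → ≤-refl {0ℝ}
        1F → ≤-trans {0ℝ} {β} {α} 0≤β β≤α
        2F → 0≤β
        3F → 0≤β
        4F → 0≤β
        5F → 0≤β
        6F → ≤-refl {0ℝ}
    }

  totalWeight≈ : totalWeight extremal ≈ α + 4 · β
  totalWeight≈ = ≗⇒≈ {totalWeight extremal} {α + 4 · β} λ n →
    solve 2 (λ a b → con 0ℚ :+ (a :+ (b :+ (b :+ (b :+ (b :+ (con 0ℚ :+ con 0ℚ)))))) :=
      a :+ (b :+ (b :+ (b :+ (b :+ con 0ℚ))))) refl (seq α n) (seq β n)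
    where open +-*-Solver

  twoHeaviest : TwoHeaviest extremal α β
  twoHeaviest = 1F , 2F , (λ ()) , ≈-refl {α} , ≈-refl {β} , β≤α , λ where
    0F _ _ → 0≤β
    1F 1≢1 _ → contradiction refl 1≢1
    2F _ 2≢2 → contradiction refl 2≢2
    3F _ _ → ≤-refl {β}
    4F _ _ → ≤-refl {β}
    5F _ _ → ≤-refl {β}
    6F _ _ → 0≤β

  cost≈ : ∀ T → cost extremal T ≈ depth T 1F · α + βDepth T · β
  cost≈ T = linear-cost α β (depth T 0F) (depth T 1F) (depth T 2F) (depth T 3F)
    (depth T 4F) (depth T 5F) (depth T 6F)

  chain-optimal : 2 · β ≤ α → Optimal extremal chain
  chain-optimal 2β≤α T = begin
    cost extremal chain
      ≈⟨ cost≈ chain ⟩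
    1 · α + 14 · β
      -- In the chain the β's lie at depths 2, 3, 4, 5, which sum to 14, and 2 + 14 is exactly the
      -- integer bound 16. The key `0F` serves as a second key, forcing the depth of α to be
      -- positive.
      ≲⟨ α+kβ≤Aα+Bβ {α} {β} 14 (depth T 1F) (βDepth T) 0≤β 2β≤α
           (depth-positive T {1F} {0F} λ ()) (16≤2αDepth+βDepth T) ⟩
    depth T 1F · α + βDepth T · β
      ≈⟨ cost≈ T ⟨
    cost extremal T ∎
    where open ≤-Reasoning

mainTheorem5 : (α β : ℝ) → 0ℝ ≤ β → β ≤ α → α + 4 · β ≈ 1ℝ → fromℚ (+ 1 / 3) ≤ α →
    ∃[ n ] Σ[ I ∈ Instance n ]
    (totalWeight I ≈ 1ℝ × TwoHeaviest I α β ×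
    (Σ[ T ∈ 2WCST n ] (Optimal I T × RootedAtTwoEqualTo (tree T))))
mainTheorem5 α β 0≤β β≤α α+4β≈1 ⅓≤α =
  7 , I ,
  ≈-trans {totalWeight I} {α + 4 · β} {1ℝ} (totalWeight≈ α β 0≤β β≤α) α+4β≈1 ,
  twoHeaviest α β 0≤β β≤α ,
  chain , chain-optimal α β 0≤β β≤α (2β≤α α β α+4β≈1 ⅓≤α) , twoEqualTo
  where
  I : Instance 7
  I = extremal α β 0≤β β≤α
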